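{- For every integer $n\geqslant 9$, the Pancake graph $P_n$ satisfies $$\chi(P_n)\leqslant 4\left\lfloor\frac n9\right\rfloor+\chi\left(P_{n \bmod 9}\right),$$ where $n \bmod 9\in\{0,1,\ldots,8\}$ and the conventions $\chi(P_0)=0$ and $\chi(P_1)=1$ are used.
   Context: For $n\geqslant 1$, the Pancake graph $P_n$ is the Cayley graph on the symmetric group $\mathrm{Sym}_n$, with permutations written in one-line notation $\pi=[\pi_1\pi_2\ldots\pi_n]$. Its generating set consists of the prefix-reversals $r_i$, $2\leqslant i\leqslant n$. Multiplying $\pi$ on the right by $r_i$ reverses the first $i$ entries: $\pi r_i=[\pi_i\pi_{i-1}\ldots\pi_1\pi_{i+1}\ldots\pi_n]$. Two vertices $\pi,\sigma$ are adjacent iff $\sigma=\pi r_i$ for some $2\leqslant i\leqslant n$. In particular $P_1$ is a single vertex. $\chi$ denotes the chromatic number. The paper uses that $\chi(P_9)=4$. -}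

module Defs where

open import Data.Fin.Base using (Fin; zero; suc; toℕ; fromℕ<; combine; remQuot; finToFun; funToFin; punchIn; punchOut)
open import Data.Fin.Properties
  using (_≟_; any?; all?; toℕ-fromℕ<; toℕ-injective; toℕ<n; remQuot-combine; finToFun-funToFin; punchOut-cong)
open import Data.Fin.Permutation
  using (Permutation′; permutation; id; _⟨$⟩ʳ_; _⟨$⟩ˡ_; _≈_; _∘ₚ_; insert; remove; insert-remove; inverseˡ)
open import Data.Nat.Base using (ℕ; zero; suc; _∸_; _^_; _≤_; _<_; _!; z≤n; s≤s)
open import Data.Nat.Properties
  using (_<?_; _≤?_; ≤-trans; <-≤-trans; ∸-monoʳ-<; m∸[m∸n]≡n; ≤-pred; m>n⇒m∸n≢0)
open import Data.Product.Base using (Σ-syntax; ∃; ∃-syntax; _×_; _,_; proj₁; proj₂)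
open import Function.Base using (_∘_)
open import Function.Bundles using (Func; LeftInverse)
open import Level using (0ℓ)
open import Relation.Binary.Bundles using (Setoid)
open import Relation.Binary.Core using (Rel)
open import Relation.Binary.Definitions using (Irreflexive; Symmetric; _Respects₂_)
import Relation.Binary.Definitions as B
import Relation.Unary as U
open import Relation.Binary.PropositionalEquality.Core
  using (_≡_; _≢_; refl; sym; trans; cong; cong₂; subst)
open import Relation.Binary.PropositionalEquality.Properties using (setoid; module ≡-Reasoning)
open import Relation.Nullary using (¬_; Dec; yes; no; contradiction)
open import Relation.Nullary.Decidable using (map′; _×-dec_; _→-dec_; ¬?)

record Graph : Set₁ where
  field
    vertices : Setoid 0ℓ 0ℓ

  open Setoid vertices public
    using () renaming (Carrier to Vertex; _≈_ to _≈ᵥ_; refl to ≈ᵥ-refl; sym to ≈ᵥ-sym; trans to ≈ᵥ-trans)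

  field
    Adjacent       : Rel Vertex 0ℓ
    Adjacent-resp  : Adjacent Respects₂ _≈ᵥ_
    Adjacent-irr   : Irreflexive _≈ᵥ_ Adjacent
    Adjacent-sym   : Symmetric Adjacent

Colourable : Graph → ℕ → Set
Colourable G k =
  Σ[ c ∈ Func vertices (setoid (Fin k)) ]
    (∀ {u v} → Adjacent u v → Func.to c u ≢ Func.to c v)
  where open Graph G

IsChromaticNumber : Graph → ℕ → Set
IsChromaticNumber G k = Colourable G k × (∀ {j} → Colourable G j → k ≤ j)

-- The enumeration may list a vertex several times, so `size` is only an
-- upper bound on the number of vertices.
record FiniteGraph : Set₁ where
  field
    graph : Graph

  open Graph graph public

  field
    size        : ℕ
    enumeration : LeftInverse (setoid (Fin size)) vertices
    Adjacent?   : B.Decidable Adjacent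

private
  least : {P : ℕ → Set} → U.Decidable P → ∀ n → P n →
          ∃[ k ] P k × (∀ {j} → P j → k ≤ j)
  least P? n p with P? zero
  least P? n           p | yes p₀ = zero , p₀ , λ _ → z≤n
  least P? zero        p | no ¬p₀ = contradiction p ¬p₀
  least {P} P? (suc n) p | no ¬p₀ with least (P? ∘ suc) n p
  ... | k , pₖ , min = suc k , pₖ , min′ _
    where
    min′ : ∀ j → P j → suc k ≤ j
    min′ zero    p₀ = contradiction p₀ ¬p₀
    min′ (suc j) pⱼ = s≤s (min pⱼ)

module _ (G : FiniteGraph) where
  open FiniteGraph G
  private
    module E = LeftInverse enumeration

    ProperOnEnumeration : ∀ {k} → (Fin size → Fin k) → Set
    ProperOnEnumeration f = ∀ a b → Adjacent (E.to a) (E.to b) → f a ≢ f b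

    properOnEnumeration? : ∀ {k} (f : Fin size → Fin k) → Dec (ProperOnEnumeration f)
    properOnEnumeration? f =
      all? λ a → all? λ b → Adjacent? (E.to a) (E.to b) →-dec ¬? (f a ≟ f b)

    reindex : ∀ {u v} → Adjacent u v → Adjacent (E.to (E.from u)) (E.to (E.from v))
    reindex {u} {v} =
      proj₁ Adjacent-resp (≈ᵥ-sym (E.strictlyInverseˡ v))
      ∘ proj₂ Adjacent-resp (≈ᵥ-sym (E.strictlyInverseˡ u))

    fromEnumeration : ∀ {k} → ∃ (λ (x : Fin (k ^ size)) → ProperOnEnumeration (finToFun {k} {size} x)) →
                      Colourable graph k
    fromEnumeration (x , proper) =
      record { to = finToFun x ∘ E.from ; cong = cong (finToFun x) ∘ E.from-cong } ,
      λ u~v → proper _ _ (reindex u~v)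

    toEnumeration : ∀ {k} → Colourable graph k →
                    ∃ (λ (x : Fin (k ^ size)) → ProperOnEnumeration (finToFun {k} {size} x))
    toEnumeration (c , proper) = funToFin f , λ a b a~b eq →
      proper a~b (trans (sym (finToFun-funToFin f a)) (trans eq (finToFun-funToFin f b)))
      where f = Func.to c ∘ E.to

  colourable? : U.Decidable (Colourable graph)
  colourable? k = map′ fromEnumeration toEnumeration (any? {n = k ^ size} (properOnEnumeration? ∘ finToFun))

  size-colourable : Colourable graph size
  size-colourable =
    record { to = E.from ; cong = E.from-cong } ,
    λ {u} {v} u~v eq → Adjacent-irr
      (≈ᵥ-trans (≈ᵥ-sym (E.strictlyInverseˡ u)) (E.inverseˡ eq)) u~v

-- Opaque because evaluating χ would run an exhaustive search.
opaque
  χ : FiniteGraph → ℕ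
  χ G = proj₁ (least (colourable? G) _ (size-colourable G))

  χ-isChromaticNumber : ∀ G → IsChromaticNumber (FiniteGraph.graph G) (χ G)
  χ-isChromaticNumber G = proj₂ (least (colourable? G) _ (size-colourable G))

-- π stands for the one-line notation [ π ⟨$⟩ʳ 0 , π ⟨$⟩ʳ 1 , … ].
Sym : ℕ → Setoid 0ℓ 0ℓ
Sym n = record
  { Carrier       = Permutation′ n
  ; _≈_           = _≈_
  ; isEquivalence = record
    { refl  = λ _ → refl
    ; sym   = λ p i → sym (p i)
    ; trans = λ p q i → trans (p i) (q i)
    }
  }

private
  insert-cong : ∀ {n} i j {π ρ : Permutation′ n} → π ≈ ρ → insert i j π ≈ insert i j ρ
  insert-cong i j p k with i ≟ k
  ... | yes _   = refl
  ... | no  _   = cong (punchIn j) (p _)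

  remove-cong : ∀ {n} i {π ρ : Permutation′ (suc n)} → π ≈ ρ → remove i π ≈ remove i ρ
  remove-cong i p k = punchOut-cong₂ (p i) (p _)
    where
    punchOut-cong₂ : ∀ {n} {a a′ b b′ : Fin (suc n)} {a≢b : a ≢ b} {a′≢b′ : a′ ≢ b′} →
                     a ≡ a′ → b ≡ b′ → punchOut a≢b ≡ punchOut a′≢b′
    punchOut-cong₂ {a = a} refl q = punchOut-cong a q

  decode : ∀ n → Fin (n !) → Permutation′ n
  decode zero    _ = id
  decode (suc n) x = insert zero (proj₁ (remQuot {suc n} (n !) x)) (decode n (proj₂ (remQuot {suc n} (n !) x)))

  encode : ∀ n → Permutation′ n → Fin (n !)
  encode zero    _ = zero
  encode (suc n) π = combine (π ⟨$⟩ʳ zero) (encode n (remove zero π))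

  encode-cong : ∀ n {π ρ} → π ≈ ρ → encode n π ≡ encode n ρ
  encode-cong zero    p = refl
  encode-cong (suc n) {π} {ρ} p =
    cong₂ combine (p zero) (encode-cong n (remove-cong zero {π} {ρ} p))

  decode-encode : ∀ n π → decode n (encode n π) ≈ π
  decode-encode (suc n) π k = begin
    decode (suc n) (combine i x) ⟨$⟩ʳ k ≡⟨ cong (λ jy → insert zero (proj₁ jy) (decode n (proj₂ jy)) ⟨$⟩ʳ k) (remQuot-combine i x) ⟩
    insert zero i (decode n x) ⟨$⟩ʳ k   ≡⟨ insert-cong zero i {decode n x} {ρ} (decode-encode n ρ) k ⟩
    insert zero i ρ ⟨$⟩ʳ k              ≡⟨ insert-remove zero π k ⟩
    π ⟨$⟩ʳ k                            ∎
    where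
    open ≡-Reasoning
    i = π ⟨$⟩ʳ zero
    ρ = remove zero π
    x = encode n ρ

Sym-enumeration : ∀ n → LeftInverse (setoid (Fin (n !))) (Sym n)
Sym-enumeration n = record
  { to        = decode n
  ; from      = encode n
  ; to-cong   = λ { refl _ → refl }
  ; from-cong = λ {π} {ρ} → encode-cong n {π} {ρ}
  ; inverseˡ  = λ { {π} refl → decode-encode n π }
  }

-- Positions are numbered from 0, so reversing the first i entries
-- exchanges the positions j and i ∸ 1 ∸ j for j < i.
reversePosition : ∀ {n} → Fin (suc n) → Fin n → Fin n
reversePosition i j with toℕ j <? toℕ i
... | yes j<i = fromℕ< (<-≤-trans (∸-monoʳ-< {toℕ i} (s≤s z≤n) j<i) (≤-pred (toℕ<n i)))
... | no  _   = j

private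
  toℕ-reversePosition : ∀ {n} (i : Fin (suc n)) (j : Fin n) → toℕ j < toℕ i →
                        toℕ (reversePosition i j) ≡ toℕ i ∸ suc (toℕ j)
  toℕ-reversePosition i j j<i with toℕ j <? toℕ i
  ... | yes _   = toℕ-fromℕ< _
  ... | no  j≮i = contradiction j<i j≮i

  reversePosition-involutive : ∀ {n} (i : Fin (suc n)) j → reversePosition i (reversePosition i j) ≡ j
  reversePosition-involutive i j = toℕ-injective (go (toℕ j <? toℕ i))
    where
    fixed : ∀ {n} (i : Fin (suc n)) (j : Fin n) → ¬ toℕ j < toℕ i → reversePosition i j ≡ j
    fixed i j j≮i with toℕ j <? toℕ i
    ... | yes j<i = contradiction j<i j≮i
    ... | no  _   = refl

    reflect : ∀ {k l} → l < k → k ∸ suc (k ∸ suc l) ≡ l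
    reflect (s≤s l≤k) = m∸[m∸n]≡n l≤k

    go : Dec (toℕ j < toℕ i) → toℕ (reversePosition i (reversePosition i j)) ≡ toℕ j
    go (no  j≮i) = cong toℕ (trans (cong (reversePosition i) (fixed i j j≮i)) (fixed i j j≮i))
    go (yes j<i) = begin
      toℕ (reversePosition i (reversePosition i j)) ≡⟨ toℕ-reversePosition i _ lt ⟩
      toℕ i ∸ suc (toℕ (reversePosition i j))       ≡⟨ cong (λ x → toℕ i ∸ suc x) eq ⟩
      toℕ i ∸ suc (toℕ i ∸ suc (toℕ j))             ≡⟨ reflect j<i ⟩
      toℕ j                                         ∎
      where
      open ≡-Reasoning
      eq = toℕ-reversePosition i j j<i
      lt : toℕ (reversePosition i j) < toℕ i
      lt = subst (_< toℕ i) (sym eq) (∸-monoʳ-< {toℕ i} (s≤s z≤n) j<i)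

-- Every prefix length i ≤ n is allowed here; for i ≤ 1 this is the identity.
prefixReversal : ∀ {n} → Fin (suc n) → Permutation′ n
prefixReversal i =
  permutation (reversePosition i) (reversePosition i)
    (reversePosition-involutive i) (reversePosition-involutive i)

-- _∘ₚ_ composes from left to right, so the one-line notation of
-- prefixReversal i ∘ₚ π is that of π with its first i entries reversed.
PancakeAdjacent : ∀ {n} → Rel (Permutation′ n) 0ℓ
PancakeAdjacent {n} π σ =
  ∃[ i ] 2 ≤ toℕ {suc n} i × σ ≈ prefixReversal i ∘ₚ π

private
  moves-first : ∀ {n} (i : Fin (suc (suc n))) → 2 ≤ toℕ i → reversePosition i zero ≢ zero
  moves-first i 2≤i eq = m>n⇒m∸n≢0 2≤i
    (trans (sym (toℕ-reversePosition i zero (≤-trans (s≤s z≤n) 2≤i))) (cong toℕ eq))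

  pancake-irr : ∀ {n} → Irreflexive _≈_ (PancakeAdjacent {n})
  pancake-irr {zero}      p (zero , () , _)
  pancake-irr {suc n} {π} p (i , 2≤i , q) = moves-first i 2≤i (begin
    reversePosition i zero                    ≡⟨ inverseˡ π ⟨
    _                                         ≡⟨ cong (π ⟨$⟩ˡ_) (trans (p zero) (q zero)) ⟨
    _                                         ≡⟨ inverseˡ π ⟩
    zero                                      ∎)
    where open ≡-Reasoning

  pancake-sym : ∀ {n} → Symmetric (PancakeAdjacent {n})
  pancake-sym {x = π} (i , 2≤i , q) = i , 2≤i , λ j →
    sym (trans (q (reversePosition i j)) (cong (π ⟨$⟩ʳ_) (reversePosition-involutive i j)))

Pancake : ℕ → FiniteGraph
Pancake n = record
  { graph = record
    { vertices      = Sym n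
    ; Adjacent      = PancakeAdjacent
    ; Adjacent-resp =
        (λ p (i , 2≤i , q) → i , 2≤i , λ j → trans (sym (p j)) (q j)) ,
        (λ p (i , 2≤i , q) → i , 2≤i , λ j → trans (q j) (p _))
    ; Adjacent-irr  = λ {π} {σ} → pancake-irr {n} {π} {σ}
    ; Adjacent-sym  = λ {π} {σ} → pancake-sym {n} {π} {σ}
    }
  ; size        = n !
  ; enumeration = Sym-enumeration n
  ; Adjacent?   = λ π σ → any? λ i →
      (2 ≤? toℕ i) ×-dec all? λ j → (σ ⟨$⟩ʳ j) ≟ ((prefixReversal i ∘ₚ π) ⟨$⟩ʳ j)
  }

-- Pancake 0 has one vertex, the empty permutation, so the convention
-- χ(P₀) = 0 has to be imposed separately; χ(P₁) = 1 needs no special case.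
χP : ℕ → ℕ
χP zero        = 0
χP n@(suc _)   = χ (Pancake n)

{-# OPTIONS --safe #-}

-- Colour a permutation of m + n values by looking at its first entry: if that
-- entry is one of the m small values, use a colouring of P_m on the subword of
-- small values, otherwise a disjoint colouring of P_n on the subword of large
-- values.  A prefix reversal whose old and new first entries lie in the same
-- class reverses a prefix of length at least 2 of the corresponding subword, so
-- the result is proper and χ(P_{m+n}) ≤ χ(P_m) + χ(P_n).
--
-- It remains to 4-colour P_9.  The odd-order group C₃ ≀ C₃, acting on the values
-- in three blocks of three, contains no conjugate of a prefix reversal, so the
-- quotient of P_9 by it has no loops.  The quotient has 9!/81 = 4480 vertices,
-- and a 4-colouring of it is given by an explicit table.

module Submission where

open import Defs
open import Data.Bool.Base using (true; false; if_then_else_)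
open import Data.Fin.Base as Fin using (Fin; zero; suc; toℕ; fromℕ<; cast; punchOut; splitAt; remQuot; _↑ˡ_; _↑ʳ_)
open import Data.Fin.Patterns using (0F; 1F; 2F)
open import Data.Fin.Permutation using (Permutation′; permutation; id; _⟨$⟩ʳ_; _⟨$⟩ˡ_; inverseˡ)
open import Data.Fin.Properties
  using (_≟_; all?; any?; toℕ<n; toℕ-injective; toℕ-fromℕ<; cast-is-id; injective⇒≤; punchOut-injective;
         splitAt-↑ˡ; splitAt-↑ʳ; splitAt⁻¹-↑ˡ; splitAt⁻¹-↑ʳ; ↑ˡ-injective; ↑ʳ-injective; combine-remQuot)
open import Data.List.Base
  using (List; []; _∷_; [_]; _++_; _ʳ++_; length; lookup; map; mapMaybe; reverse; take; drop; filter; tabulate; allFin;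
         upTo; downFrom; applyUpTo; initLast; _∷ʳ′_)
open import Data.List.Membership.DecPropositional using () renaming (_∈?_ to member?)
open import Data.List.Membership.Propositional using (_∉_)
open import Data.List.Membership.Propositional.Properties using (∈-lookup)
open import Data.List.Properties
  using (++-assoc; ++-identityʳ; length-++; length-map; length-take; length-tabulate; length-upTo; map-++; map-∘;
         map-cong; map-injective; map-tabulate; mapMaybe-++; reverse-++; reverse-map; reverse-upTo; unfold-reverse;
         tabulate-cong; tabulate-lookup; take++drop≡id; take-map; drop-map; ∷-injectiveˡ; ∷-injectiveʳ)
open import Data.List.Relation.Unary.All as All using (All; []; _∷_)
open import Data.List.Relation.Unary.AllPairs using ([]; _∷_; allPairs?)
open import Data.List.Relation.Unary.Any as Any using (Any; here; there)
open import Data.List.Relation.Unary.Unique.Propositional using (Unique)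
open import Data.List.Relation.Unary.Unique.Propositional.Properties using (tabulate⁺; map⁺)
open import Data.Maybe.Base using (Maybe; just; nothing)
open import Data.Nat.Base using (ℕ; zero; suc; _+_; _*_; _∸_; _⊓_; _^_; _≤_; _<_; z≤n; s≤s)
open import Data.Nat.DivMod using (_/_; _%_; _mod_; m≥n⇒m/n>0; m≡m%n+[m/n]*n)
open import Data.Nat.Properties
  using (_<?_; ≤-antisym; ≤-pred; ≤-reflexive; ≤-trans; 1+n≰n; m≤m+n; m≤n+m; m+n≮m; m+[n∸m]≡n; m≤n⇒m⊓n≡m; m^n≢0;
         suc-injective; +-suc; +-comm; *-comm; +-cancelˡ-≤; +-cancelʳ-≤; +-monoˡ-≤; +-monoʳ-≤)
  renaming (_≟_ to _ℕ≟_)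
open import Data.Product.Base using (Σ-syntax; ∃; _×_; _,_; proj₁; proj₂; uncurry)
open import Data.Product.Properties using (≡-dec)
open import Data.Sum using (isInj₁; isInj₂)
open import Data.Sum.Base as Sum using (_⊎_; inj₁; inj₂)
open import Function.Base using (_∘_; case_of_)
open import Function.Bundles using (Func)
open import Function.Definitions using (Injective)
open import Relation.Binary.PropositionalEquality
  using (_≡_; _≢_; refl; sym; trans; cong; cong₂; subst; subst₂; module ≡-Reasoning)
open import Relation.Nullary using (Dec; yes; no; does; contradiction)
open import Relation.Nullary.Decidable using (map′; from-yes; dec-true; dec-false; _×-dec_; _⊎-dec_; _→-dec_; ¬?)
open import Relation.Unary using (Decidable)

-- Prefix reversals of words

-- Having two distinct end positions forces the reversed prefix to have length at least 2. The old
-- and new first letters `x` and `y` are exposed because the combined colouring branches on them.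
data Flip {A : Set} : List A → List A → Set where
  flip : ∀ x ws y vs → Flip (x ∷ ws ++ y ∷ vs) (y ∷ reverse ws ++ x ∷ vs)

Flip-map : ∀ {A B : Set} (f : A → B) {xs ys} → Flip xs ys → Flip (map f xs) (map f ys)
Flip-map f (flip x ws y vs)
  rewrite map-++ f ws (y ∷ vs) | map-++ f (reverse ws) (x ∷ vs) | reverse-map f ws
  = flip _ _ _ _

Arrangement : ∀ {n} → List (Fin n) → Set
Arrangement {n} xs = Unique xs × length xs ≡ n

-- The colouring is total on lists and properness is asked only of arrangements, so a filtered
-- subword can be coloured before it is known to be an arrangement.
WordColouring : ℕ → ℕ → Set
WordColouring n k =
  Σ[ c ∈ (List (Fin n) → Fin k) ]
    (∀ {xs ys} → Arrangement xs → Arrangement ys → Flip xs ys → c xs ≢ c ys)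

-- Words and permutations

reverse-ends : ∀ {A : Set} x (ws : List A) y vs →
               reverse (x ∷ ws ++ [ y ]) ++ vs ≡ y ∷ reverse ws ++ x ∷ vs
reverse-ends x ws y vs = begin
  reverse (x ∷ ws ++ [ y ]) ++ vs        ≡⟨ cong (_++ vs) (unfold-reverse x (ws ++ [ y ])) ⟩
  (reverse (ws ++ [ y ]) ++ [ x ]) ++ vs ≡⟨ ++-assoc (reverse (ws ++ [ y ])) [ x ] vs ⟩
  reverse (ws ++ [ y ]) ++ x ∷ vs        ≡⟨ cong (_++ x ∷ vs) (reverse-++ ws [ y ]) ⟩
  y ∷ reverse ws ++ x ∷ vs               ∎
  where open ≡-Reasoning

split-Flip : ∀ {A : Set} (us vs : List A) → 2 ≤ length us → Flip (us ++ vs) (reverse us ++ vs)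
split-Flip (x ∷ us) vs 2≤ with initLast us
split-Flip (x ∷ _)  vs (s≤s ()) | []
... | ws ∷ʳ′ y =
  subst₂ Flip (sym (cong (x ∷_) (++-assoc ws [ y ] vs))) (sym (reverse-ends x ws y vs)) (flip x ws y vs)

Flip-split : ∀ {A : Set} {xs ys : List A} → Flip xs ys →
             ∃ λ us → ∃ λ vs → 2 ≤ length us × xs ≡ us ++ vs × ys ≡ reverse us ++ vs
Flip-split (flip x ws y vs) =
  x ∷ ws ++ [ y ] , vs , s≤s 1≤ , cong (x ∷_) (sym (++-assoc ws [ y ] vs)) , sym (reverse-ends x ws y vs)
  where
  1≤ : 1 ≤ length (ws ++ [ y ])
  1≤ rewrite length-++ ws {[ y ]} = m≤n+m 1 (length ws)

flipAt : ∀ {A : Set} → ℕ → List A → List A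
flipAt k xs = reverse (take k xs) ++ drop k xs

flipAt-length : ∀ {A : Set} (us vs : List A) → flipAt (length us) (us ++ vs) ≡ reverse us ++ vs
flipAt-length us vs = cong₂ (λ a b → reverse a ++ b) (take≡ us) (drop≡ us)
  where
  take≡ : ∀ us → take (length us) (us ++ vs) ≡ us
  take≡ []       = refl
  take≡ (u ∷ us) = cong (u ∷_) (take≡ us)
  drop≡ : ∀ us → drop (length us) (us ++ vs) ≡ vs
  drop≡ []       = refl
  drop≡ (_ ∷ us) = drop≡ us

map-flipAt : ∀ {A B : Set} (f : A → B) k xs → map f (flipAt k xs) ≡ flipAt k (map f xs)
map-flipAt f k xs
  rewrite map-++ f (reverse (take k xs)) (drop k xs) | reverse-map f (take k xs)
        | take-map {f = f} k xs | drop-map {f = f} k xs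
  = refl

tabulate-toℕ : ∀ {A : Set} (g : ℕ → A) n → tabulate {n = n} (g ∘ toℕ) ≡ applyUpTo g n
tabulate-toℕ g zero    = refl
tabulate-toℕ g (suc n) = cong (g 0 ∷_) (tabulate-toℕ (g ∘ suc) n)

applyUpTo-+ : ∀ {A : Set} (g : ℕ → A) k m → applyUpTo g (k + m) ≡ applyUpTo g k ++ applyUpTo (g ∘ (k +_)) m
applyUpTo-+ g zero    m = refl
applyUpTo-+ g (suc k) m = cong (g 0 ∷_) (applyUpTo-+ (g ∘ suc) k m)

applyUpTo-cong : ∀ {A : Set} {f g : ℕ → A} n → (∀ {j} → j < n → f j ≡ g j) → applyUpTo f n ≡ applyUpTo g n
applyUpTo-cong zero    eq = refl
applyUpTo-cong (suc n) eq = cong₂ _∷_ (eq (s≤s z≤n)) (applyUpTo-cong n (eq ∘ s≤s))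

downFrom-applyUpTo : ∀ k → downFrom k ≡ applyUpTo (λ j → k ∸ suc j) k
downFrom-applyUpTo zero    = refl
downFrom-applyUpTo (suc k) = cong (k ∷_) (downFrom-applyUpTo k)

-- `reversePosition` on natural numbers, where a range of positions can be split at `k` without
-- bounds to carry along.
reflect : ℕ → ℕ → ℕ
reflect k j = if does (j <? k) then k ∸ suc j else j

toℕ-reversePosition : ∀ {n} (i : Fin (suc n)) j → toℕ (reversePosition i j) ≡ reflect (toℕ i) (toℕ j)
toℕ-reversePosition i j with toℕ j <? toℕ i
... | yes j<i rewrite dec-true  (toℕ j <? toℕ i) j<i = toℕ-fromℕ< _
... | no  j≮i rewrite dec-false (toℕ j <? toℕ i) j≮i = refl

-- Below `k` the positions count down, which is the reversed initial range; from `k` on they are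
-- fixed.
applyUpTo-reflect : ∀ k m → applyUpTo (reflect k) (k + m) ≡ flipAt k (upTo (k + m))
applyUpTo-reflect k m = begin
  applyUpTo (reflect k) (k + m)
    ≡⟨ applyUpTo-+ (reflect k) k m ⟩
  applyUpTo (reflect k) k ++ applyUpTo (reflect k ∘ (k +_)) m
    ≡⟨ cong₂ _++_ (applyUpTo-cong k below) (applyUpTo-cong m λ {j} _ → above j) ⟩
  applyUpTo (λ j → k ∸ suc j) k ++ applyUpTo (k +_) m
    ≡⟨ cong (_++ applyUpTo (k +_) m) (trans (reverse-upTo k) (downFrom-applyUpTo k)) ⟨
  reverse (upTo k) ++ applyUpTo (k +_) m
    ≡⟨ flipAt-length (upTo k) _ ⟨
  flipAt (length (upTo k)) (upTo k ++ applyUpTo (k +_) m)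
    ≡⟨ cong₂ flipAt (length-upTo k) (sym (applyUpTo-+ (λ j → j) k m)) ⟩
  flipAt k (upTo (k + m)) ∎
  where
  open ≡-Reasoning
  below : ∀ {j} → j < k → reflect k j ≡ k ∸ suc j
  below {j} j<k rewrite dec-true (j <? k) j<k = refl
  above : ∀ j → reflect k (k + j) ≡ k + j
  above j rewrite dec-false (k + j <? k) (m+n≮m k j) = refl

-- Both sides are images under `f` of lists of positions, and these may be compared after the
-- injective map `toℕ`.
tabulate-reversePosition : ∀ {A : Set} {n} (i : Fin (suc n)) (f : Fin n → A) →
                           tabulate (f ∘ reversePosition i) ≡ flipAt (toℕ i) (tabulate f)
tabulate-reversePosition {n = n} i f = begin
  tabulate (f ∘ reversePosition i)   ≡⟨ map-tabulate (reversePosition i) f ⟨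
  map f (tabulate (reversePosition i)) ≡⟨ cong (map f) (map-injective toℕ-injective positions) ⟩
  map f (flipAt (toℕ i) (allFin n))  ≡⟨ map-flipAt f (toℕ i) (allFin n) ⟩
  flipAt (toℕ i) (map f (allFin n))  ≡⟨ cong (flipAt (toℕ i)) (map-tabulate (λ j → j) f) ⟩
  flipAt (toℕ i) (tabulate f)        ∎
  where
  open ≡-Reasoning
  k = toℕ i
  reflected : applyUpTo (reflect k) n ≡ flipAt k (upTo n)
  -- As `i` lies in `Fin (suc n)`, `k` is at most `n`, so `n` is `k + (n ∸ k)`.
  reflected = subst (λ n → applyUpTo (reflect k) n ≡ flipAt k (upTo n))
                    (m+[n∸m]≡n (≤-pred (toℕ<n i))) (applyUpTo-reflect k (n ∸ k))
  positions : map toℕ (tabulate (reversePosition i)) ≡ map toℕ (flipAt k (allFin n))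
  positions = begin
    map toℕ (tabulate (reversePosition i)) ≡⟨ map-tabulate (reversePosition i) toℕ ⟩
    tabulate (toℕ ∘ reversePosition i)     ≡⟨ tabulate-cong (toℕ-reversePosition i) ⟩
    tabulate (reflect k ∘ toℕ)             ≡⟨ tabulate-toℕ (reflect k) n ⟩
    applyUpTo (reflect k) n                ≡⟨ reflected ⟩
    flipAt k (upTo n)                      ≡⟨ cong (flipAt k) (tabulate-toℕ (λ j → j) n) ⟨
    flipAt k (tabulate toℕ)                ≡⟨ cong (flipAt k) (map-tabulate (λ j → j) toℕ) ⟨
    flipAt k (map toℕ (allFin n))          ≡⟨ map-flipAt toℕ k (allFin n) ⟨
    map toℕ (flipAt k (allFin n))          ∎

oneLine : ∀ {n} → Permutation′ n → List (Fin n)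
oneLine π = tabulate (π ⟨$⟩ʳ_)

oneLine-arrangement : ∀ {n} (π : Permutation′ n) → Arrangement (oneLine π)
oneLine-arrangement π = tabulate⁺ injective , length-tabulate _
  where
  injective : ∀ {i j} → π ⟨$⟩ʳ i ≡ π ⟨$⟩ʳ j → i ≡ j
  injective eq = trans (sym (inverseˡ π)) (trans (cong (π ⟨$⟩ˡ_) eq) (inverseˡ π))

oneLine-Flip : ∀ {n} {π σ : Permutation′ n} → PancakeAdjacent π σ → Flip (oneLine π) (oneLine σ)
oneLine-Flip {n} {π} {σ} (i , 2≤i , eq) = subst₂ Flip
  (take++drop≡id (toℕ i) (oneLine π))
  (sym (trans (tabulate-cong eq) (tabulate-reversePosition i (π ⟨$⟩ʳ_))))
  (split-Flip (take (toℕ i) (oneLine π)) _ (subst (2 ≤_) (sym length-taken) 2≤i))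
  where
  length-taken : length (take (toℕ i) (oneLine π)) ≡ toℕ i
  length-taken = trans (length-take (toℕ i) (oneLine π))
    (trans (cong (toℕ i ⊓_) (length-tabulate (π ⟨$⟩ʳ_))) (m≤n⇒m⊓n≡m (≤-pred (toℕ<n i))))

WordColouring⇒Colourable : ∀ {n k} → WordColouring n k → Colourable (FiniteGraph.graph (Pancake n)) k
WordColouring⇒Colourable (c , proper) =
  record { to = c ∘ oneLine ; cong = λ p → cong c (tabulate-cong p) } ,
  λ {π} {σ} adj → proper (oneLine-arrangement π) (oneLine-arrangement σ) (oneLine-Flip {π = π} {σ = σ} adj)

-- From words back to permutations

-- Pigeonhole: punching a missed value out of the codomain would leave an injection into a smaller
-- set.
injective⇒surjective : ∀ {n} {f : Fin n → Fin n} → Injective _≡_ _≡_ f → ∀ y → ∃ λ x → f x ≡ y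
injective⇒surjective {suc n} {f} inj y with any? (λ x → f x ≟ y)
... | yes p = p
... | no ¬p = contradiction (injective⇒≤ punched-injective) 1+n≰n
  where
  avoid : ∀ x → y ≢ f x
  avoid x eq = ¬p (x , sym eq)

  punched-injective : Injective _≡_ _≡_ (λ x → punchOut (avoid x))
  punched-injective {i} {j} eq = inj (punchOut-injective (avoid i) (avoid j) eq)

lookup-injective : ∀ {A : Set} {xs : List A} → Unique xs → Injective _≡_ _≡_ (lookup xs)
lookup-injective {xs = _ ∷ _} _           {zero}  {zero}  _  = refl
lookup-injective {xs = _ ∷ _} (x≢ ∷ _)    {zero}  {suc j} eq = contradiction eq (All.lookup x≢ (∈-lookup j))
lookup-injective {xs = _ ∷ _} (x≢ ∷ _)    {suc i} {zero}  eq = contradiction (sym eq) (All.lookup x≢ (∈-lookup i))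
lookup-injective {xs = _ ∷ _} (_ ∷ uniq) {suc i} {suc j} eq = cong suc (lookup-injective uniq eq)

letterAt : ∀ {A : Set} {n} (xs : List A) → length xs ≡ n → Fin n → A
letterAt xs len i = lookup xs (cast (sym len) i)

tabulate-letterAt : ∀ {A : Set} {n} (xs : List A) (len : length xs ≡ n) → tabulate (letterAt xs len) ≡ xs
tabulate-letterAt xs refl =
  trans (tabulate-cong (λ i → cong (lookup xs) (cast-is-id refl i))) (tabulate-lookup xs)

letterAt-injective : ∀ {A : Set} {n} {xs : List A} (len : length xs ≡ n) → Unique xs →
                     Injective _≡_ _≡_ (letterAt xs len)
letterAt-injective refl uniq {i} {j} eq =
  trans (sym (cast-is-id refl i)) (trans (lookup-injective uniq eq) (cast-is-id refl j))

fromWord : ∀ {n} {xs : List (Fin n)} → Arrangement xs → Permutation′ n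
fromWord {n} {xs} (uniq , len) =
  permutation at (proj₁ ∘ onto) (proj₂ ∘ onto) (λ i → inj (proj₂ (onto (at i))))
  where
  at : Fin n → Fin n
  at = letterAt xs len
  inj : Injective _≡_ _≡_ at
  inj = letterAt-injective len uniq
  onto : ∀ y → ∃ λ x → at x ≡ y
  onto = injective⇒surjective inj

oneLine-fromWord : ∀ {n} {xs : List (Fin n)} (arr : Arrangement xs) → oneLine (fromWord arr) ≡ xs
oneLine-fromWord {xs = xs} (_ , len) = tabulate-letterAt xs len

tabulate-injective : ∀ {A : Set} {n} {f g : Fin n → A} → tabulate f ≡ tabulate g → ∀ i → f i ≡ g i
tabulate-injective eq zero    = ∷-injectiveˡ eq
tabulate-injective eq (suc i) = tabulate-injective (∷-injectiveʳ eq) i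

fromWord-adjacent : ∀ {n} {xs ys : List (Fin n)} (arr : Arrangement xs) (arr′ : Arrangement ys) →
                    Flip xs ys → PancakeAdjacent (fromWord arr) (fromWord arr′)
fromWord-adjacent {n} {xs} {ys} arr arr′ f
  with us , vs , 2≤ , xs≡ , ys≡ ← Flip-split f
  = i , subst (2 ≤_) (sym toℕ-i) 2≤ , tabulate-injective (begin
    oneLine (fromWord arr′)                               ≡⟨ oneLine-fromWord arr′ ⟩
    ys                                                    ≡⟨ ys≡ ⟩
    reverse us ++ vs                                      ≡⟨ flipAt-length us vs ⟨
    flipAt (length us) (us ++ vs)                         ≡⟨ cong₂ flipAt (sym toℕ-i) (sym xs≡) ⟩
    flipAt (toℕ i) xs                                     ≡⟨ cong (flipAt (toℕ i)) (oneLine-fromWord arr) ⟨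
    flipAt (toℕ i) (oneLine (fromWord arr))               ≡⟨ tabulate-reversePosition i _ ⟨
    tabulate ((fromWord arr ⟨$⟩ʳ_) ∘ reversePosition i)   ∎)
  where
  open ≡-Reasoning
  us≤n : length us ≤ n
  us≤n = subst (length us ≤_) (trans (sym (length-++ us)) (trans (cong length (sym xs≡)) (proj₂ arr)))
               (m≤m+n _ (length vs))
  i : Fin (suc n)
  i = fromℕ< (s≤s us≤n)
  toℕ-i : toℕ i ≡ length us
  toℕ-i = toℕ-fromℕ< (s≤s us≤n)

arrangement? : ∀ {n} → Decidable (Arrangement {n})
arrangement? {n} xs = allPairs? (λ x y → ¬? (x ≟ y)) xs ×-dec (length xs ℕ≟ n)

Colourable⇒WordColouring : ∀ {n k} → Colourable (FiniteGraph.graph (Pancake n)) k → WordColouring n k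
Colourable⇒WordColouring {n} {k} (c , proper) = colour′ , proper′
  where
  pick : ∀ {xs} → Dec (Arrangement xs) → Permutation′ n
  pick (yes arr) = fromWord arr
  -- An arbitrary value: properness is only claimed for arrangements.
  pick (no _)    = id

  colour′ : List (Fin n) → Fin k
  colour′ xs = Func.to c (pick (arrangement? xs))

  pick-adjacent : ∀ {xs ys} (d : Dec (Arrangement xs)) (e : Dec (Arrangement ys)) → Arrangement xs → Arrangement ys →
                  Flip xs ys → PancakeAdjacent (pick d) (pick e)
  pick-adjacent (yes arr) (yes arr′) _   _    f = fromWord-adjacent arr arr′ f
  pick-adjacent (no ¬arr) _          arr _    _ = contradiction arr ¬arr
  pick-adjacent (yes _)   (no ¬arr′) _   arr′ _ = contradiction arr′ ¬arr′

  proper′ : ∀ {xs ys} → Arrangement xs → Arrangement ys → Flip xs ys → colour′ xs ≢ colour′ ys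
  proper′ {xs} {ys} arr arr′ f = proper (pick-adjacent (arrangement? xs) (arrangement? ys) arr arr′ f)

-- Subadditivity

mapMaybe-reverse : ∀ {A B : Set} (f : A → Maybe B) xs → mapMaybe f (reverse xs) ≡ reverse (mapMaybe f xs)
mapMaybe-reverse f []       = refl
mapMaybe-reverse f (x ∷ xs) = begin
  mapMaybe f (reverse (x ∷ xs))                ≡⟨ cong (mapMaybe f) (unfold-reverse x xs) ⟩
  mapMaybe f (reverse xs ++ [ x ])             ≡⟨ mapMaybe-++ f (reverse xs) [ x ] ⟩
  mapMaybe f (reverse xs) ++ mapMaybe f [ x ]  ≡⟨ cong (_++ mapMaybe f [ x ]) (mapMaybe-reverse f xs) ⟩
  reverse (mapMaybe f xs) ++ mapMaybe f [ x ]  ≡⟨ last ⟩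
  reverse (mapMaybe f (x ∷ xs))                ∎
  where
  open ≡-Reasoning
  last : reverse (mapMaybe f xs) ++ mapMaybe f [ x ] ≡ reverse (mapMaybe f (x ∷ xs))
  last with f x
  ... | just y  = sym (unfold-reverse y (mapMaybe f xs))
  ... | nothing = ++-identityʳ _

-- Injectivity on the domain of definition, which is what keeps the letters of a subword distinct.
PartiallyInjective : ∀ {A B : Set} → (A → Maybe B) → Set
PartiallyInjective f = ∀ {x x′ y} → f x ≡ just y → f x′ ≡ just y → x ≡ x′

mapMaybe-unique : ∀ {A B : Set} {f : A → Maybe B} → PartiallyInjective f →
                  ∀ {xs} → Unique xs → Unique (mapMaybe f xs)
mapMaybe-unique inj [] = []
mapMaybe-unique {f = f} inj (_∷_ {x} x≢ uniq) with f x in eq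
... | nothing = mapMaybe-unique inj uniq
... | just y  = distinct x≢ ∷ mapMaybe-unique inj uniq
  where
  distinct : ∀ {zs} → All (x ≢_) zs → All (y ≢_) (mapMaybe f zs)
  distinct [] = []
  distinct (_∷_ {z} x≢z x≢zs) with f z in eq′
  ... | nothing = distinct x≢zs
  ... | just w  = (λ { refl → x≢z (inj eq eq′) }) ∷ distinct x≢zs

-- Both end letters survive, so the reversed prefix of the subword still has length at least 2,
-- however much of `ws` is dropped.
mapMaybe-Flip : ∀ {A B : Set} (f : A → Maybe B) {x y a b} ws vs → f x ≡ just a → f y ≡ just b →
                Flip (mapMaybe f (x ∷ ws ++ y ∷ vs)) (mapMaybe f (y ∷ reverse ws ++ x ∷ vs))
mapMaybe-Flip f {x} {y} {a} {b} ws vs fx fy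
  rewrite fx | fy | mapMaybe-++ f ws (y ∷ vs) | mapMaybe-++ f (reverse ws) (x ∷ vs)
        | mapMaybe-reverse f ws | fx | fy
  = flip a (mapMaybe f ws) b (mapMaybe f vs)

unique-length : ∀ {n} {xs : List (Fin n)} → Unique xs → length xs ≤ n
unique-length uniq = injective⇒≤ (lookup-injective uniq)

module _ (m n : ℕ) where

  low : Fin (m + n) → Maybe (Fin m)
  low i = isInj₁ (splitAt m i)

  high : Fin (m + n) → Maybe (Fin n)
  high i = isInj₂ (splitAt m i)

  low-injective : PartiallyInjective low
  low-injective {i} {j} p q with splitAt m i in eq | splitAt m j in eq′
  low-injective refl refl | inj₁ a | inj₁ _ = trans (sym (splitAt⁻¹-↑ˡ eq)) (splitAt⁻¹-↑ˡ eq′)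

  high-injective : PartiallyInjective high
  high-injective {i} {j} p q with splitAt m i in eq | splitAt m j in eq′
  high-injective refl refl | inj₂ a | inj₂ _ = trans (sym (splitAt⁻¹-↑ʳ {i = _} eq)) (splitAt⁻¹-↑ʳ {i = _} eq′)

  length-low-high : ∀ xs → length (mapMaybe low xs) + length (mapMaybe high xs) ≡ length xs
  length-low-high []       = refl
  length-low-high (x ∷ xs) with splitAt m x
  ... | inj₁ _ = cong suc (length-low-high xs)
  ... | inj₂ _ = trans (+-suc _ _) (cong suc (length-low-high xs))

  module _ {xs : List (Fin (m + n))} (arr : Arrangement xs) where

    private
      low-unique  = mapMaybe-unique low-injective (proj₁ arr)
      high-unique = mapMaybe-unique high-injective (proj₁ arr)

      m+n≤ : m + n ≤ length (mapMaybe low xs) + length (mapMaybe high xs)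
      m+n≤ = ≤-reflexive (sym (trans (length-low-high xs) (proj₂ arr)))

    -- Distinctness bounds the two subwords by `m` and `n` letters; their lengths add up to `m + n`,
    -- so both bounds are attained.
    low-arrangement : Arrangement (mapMaybe low xs)
    low-arrangement = low-unique , ≤-antisym (unique-length low-unique)
      (+-cancelʳ-≤ n m _ (≤-trans m+n≤ (+-monoʳ-≤ _ (unique-length high-unique))))

    high-arrangement : Arrangement (mapMaybe high xs)
    high-arrangement = high-unique , ≤-antisym (unique-length high-unique)
      (+-cancelˡ-≤ m n _ (≤-trans m+n≤ (+-monoˡ-≤ _ (unique-length low-unique))))

WordColouring-+ : ∀ {m n j k} → WordColouring m j → WordColouring n k → WordColouring (m + n) (j + k)
WordColouring-+ {m} {n} {j} {k} (c , proper) (d , proper′) = colour⁺ , proper⁺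
  where
  pick : Fin m ⊎ Fin n → List (Fin (m + n)) → Fin (j + k)
  pick (inj₁ _) xs = c (mapMaybe (low m n) xs) ↑ˡ k
  pick (inj₂ _) xs = j ↑ʳ d (mapMaybe (high m n) xs)

  colour⁺ : List (Fin (m + n)) → Fin (j + k)
  -- The empty word takes part in no flip; this value only makes the function total.
  colour⁺ []          = c [] ↑ˡ k
  colour⁺ xs@(x ∷ _) = pick (splitAt m x) xs

  ↑ˡ≢↑ʳ : ∀ (a : Fin j) (b : Fin k) → a ↑ˡ k ≢ j ↑ʳ b
  ↑ˡ≢↑ʳ a b eq =
    case trans (sym (splitAt-↑ˡ j a k)) (trans (cong (splitAt j) eq) (splitAt-↑ʳ j k b)) of λ ()

  proper⁺ : ∀ {xs ys} → Arrangement xs → Arrangement ys → Flip xs ys → colour⁺ xs ≢ colour⁺ ys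
  proper⁺ {xs} {ys} arr arr′ (flip x ws y vs) = differ (splitAt m x) (splitAt m y) refl refl
    where
    differ : ∀ a b → splitAt m x ≡ a → splitAt m y ≡ b → pick a xs ≢ pick b ys
    differ (inj₁ _) (inj₁ _) p q eq =
      proper (low-arrangement m n arr) (low-arrangement m n arr′)
        (mapMaybe-Flip (low m n) ws vs (cong isInj₁ p) (cong isInj₁ q)) (↑ˡ-injective k _ _ eq)
    differ (inj₂ _) (inj₂ _) p q eq =
      proper′ (high-arrangement m n arr) (high-arrangement m n arr′)
        (mapMaybe-Flip (high m n) ws vs (cong isInj₂ p) (cong isInj₂ q)) (↑ʳ-injective j _ _ eq)
    differ (inj₁ _) (inj₂ _) p q eq = ↑ˡ≢↑ʳ _ _ eq
    differ (inj₂ _) (inj₁ _) p q eq = ↑ˡ≢↑ʳ _ _ (sym eq)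

-- Colouring P₉

infixl 6 _⊖_
-- Subtraction in the cyclic group of order 3.
_⊖_ : Fin 3 → Fin 3 → Fin 3
x  ⊖ 0F = x
0F ⊖ 1F = 2F
1F ⊖ 1F = 0F
2F ⊖ 1F = 1F
0F ⊖ 2F = 1F
1F ⊖ 2F = 2F
2F ⊖ 2F = 0F

⊖-cancelʳ : ∀ x y z → (x ⊖ z) ⊖ (y ⊖ z) ≡ x ⊖ y
⊖-cancelʳ = from-yes (all? λ x → all? λ y → all? λ z → (x ⊖ z) ⊖ (y ⊖ z) ≟ x ⊖ y)

⊖-self : ∀ x → x ⊖ x ≡ 0F
⊖-self = from-yes (all? λ x → x ⊖ x ≟ 0F)

⊖-zero⇒≡ : ∀ x y → x ⊖ y ≡ 0F → x ≡ y
⊖-zero⇒≡ = from-yes (all? λ x → all? λ y → (x ⊖ y ≟ 0F) →-dec (x ≟ y))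

⊖-injectiveˡ : ∀ x y z → x ⊖ z ≡ y ⊖ z → x ≡ y
⊖-injectiveˡ x y z eq = ⊖-zero⇒≡ x y (begin
  x ⊖ y             ≡⟨ ⊖-cancelʳ x y z ⟨
  (x ⊖ z) ⊖ (y ⊖ z) ≡⟨ cong (_⊖ (y ⊖ z)) eq ⟩
  (y ⊖ z) ⊖ (y ⊖ z) ≡⟨ ⊖-self (y ⊖ z) ⟩
  0F                ∎)
  where open ≡-Reasoning

-- The value 3 b + r stands for the letter r of the block b.
Letter : Set
Letter = Fin 3 × Fin 3

gap : Letter → Letter → Fin 3
gap (b , _) (b′ , _) = b′ ⊖ b

-- Forced to 0 across blocks, so that it is invariant under relabelling of any
-- two letters.
turn : Letter → Letter → ℕ
turn x@(_ , r) y@(_ , r′) = if does (gap x y ≟ 0F) then toℕ (r′ ⊖ r) ∸ 1 else 0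

-- Meant for the subword of one block: its first two letters already determine the cyclic order of
-- all three.
spin : List Letter → ℕ
spin (x ∷ y ∷ _) = turn x y
spin _           = 0

-- Blocks are addressed relative to the block of `x`, so that a rotation of the blocks goes
-- unnoticed.
atGap : Letter → Fin 3 → List Letter → List Letter
atGap x d = filter (λ y → gap x y ≟ d)

digits : ℕ → List (Fin 3) → ℕ
digits a []       = a
digits a (d ∷ ds) = digits (3 * a + toℕ d) ds

-- The blocks of the letters 2 to 8 relative to that of the first (the ninth is
-- forced) as base-3 digits, followed for each block by one bit that says whether
-- its letters appear in the cyclic order 0, 1, 2 or 0, 2, 1.
code : List Letter → ℕ
code []          = 0
code xs@(x ∷ ys) =
  8 * digits 0 (map (gap x) (take 7 ys)) +
  (4 * spin (atGap x 0F xs) + 2 * spin (atGap x 1F xs) + spin (atGap x 2F xs))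

-- Found by a tabu search.  Reading the rows in base 4 from the least significant
-- digit, the colour with code 216 i + j is digit j of row i.  Codes of no
-- arrangement have digit 0.
table : List ℕ
table =
  0x0 ∷
  0x0 ∷
  0x0 ∷
  0x0 ∷
  0x17b280e600009a3300000000000000000000b4ef00000000000000000000000000000000000000000000000000000000000000000000 ∷
  0x7ba4000016c356e10000000000000000680fc93e0000fca600000000000000000000000000000000000000000000000000000000 ∷
  0x0 ∷
  0x3de00000831c25fb0000000000000000691ecea30000590000000000000000000000000000000000000000000000000000000000 ∷
  0x861c00000000000000000000b52f000025ce0a5f0000000000000000000000000000000000000000000000000000 ∷
  0x0 ∷
  0x771238e20000224b00000000000000000000b40d00000000000000000000000000000000000000000000000000000000000000000000 ∷
  0x1f6100008fe221fe0000000000000000f8028bee0000b7ce00000000000000000000000000000000000000000000000000000000 ∷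
  0x94c230d600007c8100000000000000000000f46a00000000000000000000000000000000000000000000000000000000000000000000 ∷
  0xdbad00007708000000000000e44f0000000000000000000000000000000000000000000098c300000000000000000000000000000000 ∷
  0x275a75ebda050000866c6782334e0000c31e0000f80100000000000071d700000000258bc7700000005b00000000000000000000 ∷
  0x729c000018b68a51000000000000000021bce11b0000be4400000000000000000000000000000000000000000000000000000000 ∷
  0xce91b94e3fe20000a61f4c396f040000831d0000d8a20000000000007d9a00000000982d7029000059e200000000000000000000 ∷
  0xb44f48130000d78c00000000b25be24c7499000027dd91e659b20000000042380000fc16b9560000000000000000 ∷
  0x0 ∷
  0xf59b00007308faad000000000000000021fac39900003a6c00000000000000000000000000000000000000000000000000000000 ∷
  0x29d0000000000000000000071ee00002ed879200000000000000000000000000000000000000000000000000000 ∷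
  0xa7fa0000cf31e09900000000000000006b11e80500001bc200000000000000000000000000000000000000000000000000000000 ∷
  0xc16c2adfb3dd000038adc432dc270000fb2c0000936a00000000000064fd00000000618c87d10000de6b00000000000000000000 ∷
  0x5e39e04d00009c360000000028b1b35e194700004298c61944af000000003ca7000080ddf9640000000000000000 ∷
  0xc59800000000000000000000329b0000c96e3d660000000000000000000000000000000000000000000000000000 ∷
  0x346f7dea00003bee00000000f66c903e3a8d0000e49b64f3104a00000000e039000043a620df0000000000000000 ∷
  0x761bd671000081760000000000000000000072940000000000000000 ∷
  0x0 ∷
  0xb8120593000094f900000000000000000000f74200000000000000000000000000000000000000000000000000000000000000000000 ∷
  0xd47200009be6619a0000000000000000dfa1b8150000275d00000000000000000000000000000000000000000000000000000000 ∷
  0x379d5a030000a25f00000000000000000000e93700000000000000000000000000000000000000000000000000000000000000000000 ∷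
  0x265800002349000000000000c851000000000000000000000000000000000000000000008fe900000000000000000000000000000000 ∷
  0xd234247345ef0000e8befd97396f000022cb000031e400000000000058050000000045303a870000265800000000000000000000 ∷
  0x19ec0000b81629740000000000000000f94cb86d0000c22c00000000000000000000000000000000000000000000000000000000 ∷
  0x91ecf10c24fe0000ad53b553f9a2000005930000432800000000000020dd000000002698a97600001bf500000000000000000000 ∷
  0x1bbc3f420000c72c000000002a41cda493f900005bc229d0a631000000000f72000072df2ef10000000000000000 ∷
  0xd2d030bd0000f53a00000000000000000000fbd800000000000000000000000000000000000000000000000000000000000000000000 ∷
  0xf6ca0000843e000000000000f7e400000000000000000000000000000000000000000000349e00000000000000000000000000000000 ∷
  0x7ac10b67f69a00001f1f88d7de8300000f05000049c9000000000000ba3d00000000d712b8120000070a00000000000000000000 ∷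
  0xac14000054df0000000000005e0800000000000000000000000000000000000000000000663f00000000000000000000000000000000 ∷
  0x0 ∷
  0x99f30000000000003a0c00008f8400000000000000000000000000000000000014630000d3a500000000000034e800000000 ∷
  0x4d15074bcc6e0000d88b1b6786300000275300008ec600000000000028e50000000052a9c7a20000e14200000000000000000000 ∷
  0x17b2000000000000c1c10000583e00000000000000000000000000000000000052c20000a43a00000000000032be00000000 ∷
  0x1ca30000d74a937900000000d25800000000000017cd0000dd670000582b6ef2852a00005a4a956747d10000 ∷
  0x934900005c750e9b0000000000000000aa95af4300002fb600000000000000000000000000000000000000000000000000000000 ∷
  0x8e6cf396e0030000ac723b9c3ef90000255a0000acf50000000000007e700000000026c489ff0000f22c00000000000000000000 ∷
  0x4dd8148700003e7600000000b7b25cc4be5a0000bc9c68b3b2190000000071b100007987a76e0000000000000000 ∷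
  0x1f8e1f2ca240000067af99e7c6db0000ad6300004e93000000000000bd3e000000006f60f9790000572a00000000000000000000 ∷
  0x92740000000000001c39000090f7000000000000000000000000000000000000859f00007c15000000000000147e00000000 ∷
  0xae50000baf614c400000000358d000000000000af1300001b310000e0278c72d71b000023241f2c55fb0000 ∷
  0xe916bd4d0000aedb00000000e9ad5ed221530000911afd819a3c0000000023690000d2e6a55e0000000000000000 ∷
  0x21050000529f96d600000000d3e6000000000000e53e0000a0e80000926b0236f1300000e44eeeec378b0000 ∷
  0x506e0000836c19fb0000000000000000ac42e78b00007ffe0000 ∷
  0x0 ∷
  0x641e000093e6c3950000000000000000158af31d00001a6c00000000000000000000000000000000000000000000000000000000 ∷
  0x36ec00000000000000000000399e000022c9778e0000000000000000000000000000000000000000000000000000 ∷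
  0x5680000060cdea9300000000000000003a5c06df0000f21b00000000000000000000000000000000000000000000000000000000 ∷
  0xe93eaaf7e6130000bbc68e7518cd000022b8000029930000000000005b3c000000007b828f2600003acd00000000000000000000 ∷
  0xd94339d70000865f00000000b345641f4a9500003aac821cbd6800000000dc770000cb20e3960000000000000000 ∷
  0xc2950000000000000000000049a3000028d749bf0000000000000000000000000000000000000000000000000000 ∷
  0xbce933590000e99000000000076d4aa1e9340000a752b349720700000000396e0000d63c65380000000000000000 ∷
  0xaef1f164000021dc0000000000000000000082550000000000000000 ∷
  0xf22d00001086c4e0000000000000000062f4bc160000214500000000000000000000000000000000000000000000000000000000 ∷
  0xf929ed0cf8b500009d4675e2a3900000c1cb000068f10000000000009bc0000000009efb22340000db1c00000000000000000000 ∷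
  0x3727384300009b95000000004d696bb5a05900004907dd01f6d50000000068280000de9007190000000000000000 ∷
  0x2cadcb8978b3000001d0030baafd0000ec070000f286000000000000f36b0000000003cb7c1900005bb900000000000000000000 ∷
  0xc453000000000000431400004f5f000000000000000000000000000000000000a0fc00002c9300000000000023e800000000 ∷
  0xc1b200001073e3e8000000002c0e000000000000f14a0000647d000053133d16c8b40000512b1afda3900000 ∷
  0x4ec64dc00000b54f00000000da21a41ebbb40000c99f3c3453b900000000c09e000010bbf71b0000000000000000 ∷
  0xd4ab0000c67d2f2500000000c9a70000000000009d340000da420000bd54124f83890000f621d69f4a8f0000 ∷
  0xcaf80000ac2ecc70000000000000000030346d280000de3b0000 ∷
  0x45a00000000000000000000086700007d48ec1d0000000000000000000000000000000000000000000000000000 ∷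
  0xf92b814e0000bf350000000008bdb95d46f400002d728245ac1d000000002ee4000089bf8d520000000000000000 ∷
  0x7682ba3d00000e9200000000000000000000a0cd0000000000000000 ∷
  0x9c03e039000080f400000000722d87ed3a5e000013c943a0acc5000000006ce70000df85fe3c0000000000000000 ∷
  0xea78000090ee9c36000000006f86000000000000c9570000cd6b000043f226d005390000fe732f30ee7a0000 ∷
  0x612d000036f5cef10000000000000000276e692a0000348d0000 ∷
  0x7a6476be0000d8d400000000000000000000b6330000000000000000 ∷
  0x209800005f6134b000000000000000004d76534600004e820000 ∷
  0x0 ∷
  []

-- Checking the table on normalised words

entry : List ℕ → ℕ → ℕ
entry []       _       = 0
entry (r ∷ _)  zero    = r
entry (_ ∷ rs) (suc i) = entry rs i

-- Seven base-3 digits and three bits give codes below 8 · 3^7 = 17496 = 81 · 216, hence 81 rows of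
-- 216 digits each.
hue : ℕ → Fin 4
hue k = (entry table (k / 216) / 4 ^ (k % 216)) mod 4
  where instance _ = m^n≢0 4 (k % 216)

colour : List Letter → Fin 4
colour xs = hue (code xs)

Proper : List Letter → Set
Proper xs = ∀ ys → Flip xs ys → colour xs ≢ colour ys

-- The accumulator `us` holds the letters passed so far, already reversed, so one traversal of the
-- word meets all its flips.
flips? : ∀ (c : Fin 4) x us xs →
  Dec (∀ ws y vs → xs ≡ ws ++ y ∷ vs → c ≢ colour (y ∷ (ws ʳ++ us) ++ x ∷ vs))
flips? c x us []       = yes λ { [] _ _ () ; (_ ∷ _) _ _ () }
flips? c x us (y ∷ vs) =
  map′ (λ { (p , _) [] _ _ refl → p ; (_ , q) (_ ∷ ws) z zs refl → q ws z zs refl })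
       (λ h → h [] y vs refl , λ ws z zs eq → h (y ∷ ws) z zs (cong (y ∷_) eq))
       (¬? (c ≟ colour (y ∷ us ++ x ∷ vs)) ×-dec flips? c x (y ∷ us) vs)

proper? : Decidable Proper
proper? []       = yes λ _ ()
proper? (x ∷ xs) =
  map′ (λ { h _ (flip _ ws y vs) → h ws y vs refl }) (λ { h ws y vs refl → h _ (flip x ws y vs) })
       -- With an empty accumulator, `ws ʳ++ []` is `reverse ws` by definition.
       (flips? (colour (x ∷ xs)) x [] xs)

-- Every C₃ ≀ C₃-orbit contains a word that starts with (0 , 0) and in which each
-- block is entered at its letter 0; only those words have to be checked.
Fresh : List Letter → Letter → Set
Fresh us y = y ∉ us × (Any (λ u → proj₁ u ≡ proj₁ y) us ⊎ proj₂ y ≡ 0F)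

fresh? : ∀ us → Decidable (Fresh us)
fresh? us y =
  ¬? (member? (≡-dec _≟_ _≟_) y us) ×-dec (Any.any? (λ u → proj₁ u ≟ proj₁ y) us ⊎-dec (proj₂ y ≟ 0F))

-- The first index is the prefix already read, last letter first; walks are the branches of the
-- search tree explored by `allProper?`.
data Walk : List Letter → List Letter → Set where
  []  : ∀ {us} → Walk us []
  _∷_ : ∀ {us x xs} → Fresh us x → Walk (x ∷ us) xs → Walk us (x ∷ xs)

AllProper : ℕ → List Letter → Set
AllProper n us = ∀ xs → length xs ≡ n → Walk us xs → Proper (us ʳ++ xs)

allProper? : ∀ n us → Dec (AllProper n us)
allProper? zero us =
  map′ (λ { p [] _ _ → p }) (λ h → h [] refl []) (proper? (us ʳ++ []))
allProper? (suc n) us =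
  map′ (λ { h (_ ∷ xs) len (f ∷ w) → h _ _ f xs (suc-injective len) w })
       (λ { h b r f xs len w → h (_ ∷ xs) (cong suc len) (f ∷ w) })
       (all? λ b → all? λ r → fresh? us (b , r) →-dec allProper? n ((b , r) ∷ us))

-- Only the Boolean part of the decision has to be evaluated for `refl` to be accepted.
witness : ∀ {P : Set} (d : Dec P) → does d ≡ true → P
witness (yes p) refl = p

-- Settled by evaluation: one word for each of the 4480 orbits, with 8 flips each. The flipped words
-- need no normalising, as `colour` applies to every word.
allProper : AllProper 8 [ 0F , 0F ]
allProper = witness (allProper? 8 [ 0F , 0F ]) refl

-- Invariance under C₃ ≀ C₃

filter-map : ∀ {A B : Set} {P : B → Set} {Q : A → Set} (P? : Decidable P) (Q? : Decidable Q) (f : A → B) →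
             (∀ x → does (P? (f x)) ≡ does (Q? x)) → ∀ xs → filter P? (map f xs) ≡ map f (filter Q? xs)
filter-map P? Q? f eq []       = refl
filter-map P? Q? f eq (x ∷ xs) rewrite eq x with does (Q? x)
... | false = filter-map P? Q? f eq xs
... | true  = cong (f x ∷_) (filter-map P? Q? f eq xs)

module _ (t : Fin 3) (s : Fin 3 → Fin 3) where

  -- An element of C₃ ≀ C₃: `t` rotates the three blocks and `s b` rotates the letters inside block
  -- `b`.
  relabel : Letter → Letter
  relabel (b , r) = b ⊖ t , r ⊖ s b

  relabel-injective : ∀ {x y} → relabel x ≡ relabel y → x ≡ y
  relabel-injective {b , r} {b′ , r′} eq
    with refl ← ⊖-injectiveˡ b b′ t (cong proj₁ eq)
    = cong (b ,_) (⊖-injectiveˡ r r′ (s b) (cong proj₂ eq))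

  gap-relabel : ∀ x y → gap (relabel x) (relabel y) ≡ gap x y
  gap-relabel (b , _) (b′ , _) = ⊖-cancelʳ b′ b t

  -- Two letters of one block are shifted by the same `s b`, which cancels in their difference;
  -- across blocks both sides are 0.
  turn-relabel : ∀ x y → turn (relabel x) (relabel y) ≡ turn x y
  turn-relabel x@(b , r) y@(b′ , r′) rewrite gap-relabel x y with gap x y ≟ 0F
  ... | no  _ = refl
  ... | yes g with refl ← ⊖-zero⇒≡ b′ b g = cong (λ a → toℕ a ∸ 1) (⊖-cancelʳ r′ r (s b))

  spin-relabel : ∀ xs → spin (map relabel xs) ≡ spin xs
  spin-relabel []          = refl
  spin-relabel (_ ∷ [])    = refl
  spin-relabel (x ∷ y ∷ _) = turn-relabel x y

  atGap-relabel : ∀ x d xs → atGap (relabel x) d (map relabel xs) ≡ map relabel (atGap x d xs)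
  atGap-relabel x d = filter-map _ _ relabel λ y → cong (λ g → does (g ≟ d)) (gap-relabel x y)

  code-relabel : ∀ xs → code (map relabel xs) ≡ code xs
  code-relabel []          = refl
  code-relabel xs@(x ∷ ys) = cong₂ (λ a b → 8 * digits 0 a + b) gaps
    (cong₂ _+_ (cong₂ (λ a b → 4 * a + 2 * b) (spins 0F) (spins 1F)) (spins 2F))
    where
    gaps : map (gap (relabel x)) (take 7 (map relabel ys)) ≡ map (gap x) (take 7 ys)
    gaps = begin
      map (gap (relabel x)) (take 7 (map relabel ys)) ≡⟨ cong (map _) (take-map 7 ys) ⟩
      map (gap (relabel x)) (map relabel (take 7 ys)) ≡⟨ map-∘ (take 7 ys) ⟨
      map (gap (relabel x) ∘ relabel) (take 7 ys)     ≡⟨ map-cong (gap-relabel x) (take 7 ys) ⟩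
      map (gap x) (take 7 ys)                         ∎
      where open ≡-Reasoning
    spins : ∀ d → spin (atGap (relabel x) d (map relabel xs)) ≡ spin (atGap x d xs)
    spins d = trans (cong spin (atGap-relabel x d xs)) (spin-relabel (atGap x d xs))

  -- Relabelling values commutes with reversing positions and preserves `code`, hence colours.
  Proper-relabel : ∀ {xs} → Proper (map relabel xs) → Proper xs
  Proper-relabel {xs} p ys f eq = p _ (Flip-map relabel f)
    (trans (cong hue (code-relabel xs)) (trans eq (cong hue (sym (code-relabel ys)))))

-- Rotating each block by its leader makes the word enter that block at 0.
leader : List Letter → Fin 3 → Fin 3
leader []             _ = 0F
leader ((b , r) ∷ xs) c = if does (b ≟ c) then r else leader xs c

module _ (t : Fin 3) (s : Fin 3 → Fin 3) where

  -- The last hypothesis is the loop invariant: each block has either been entered already, or its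
  -- first letter still to come is the one that `s` sends to 0.
  relabel-walk : ∀ us xs → Unique xs → All (λ x → relabel t s x ∉ us) xs →
                 (∀ b → Any (λ u → proj₁ u ≡ b ⊖ t) us ⊎ leader xs b ≡ s b) →
                 Walk us (map (relabel t s) xs)
  relabel-walk us []              _          _            _     = []
  relabel-walk us (x@(b , r) ∷ xs) (x≢ ∷ uniq) (x∉ ∷ xs∉) known =
    (x∉ , Sum.map₂ base (known b)) ∷
    relabel-walk (relabel t s x ∷ us) xs uniq
      (All.zipWith (λ { (x≢y , y∉) (here eq) → x≢y (sym (relabel-injective t s eq))
                      ; (x≢y , y∉) (there y∈) → y∉ y∈ }) (x≢ , xs∉))
      next
    where
    base : leader (x ∷ xs) b ≡ s b → r ⊖ s b ≡ 0F
    base eq rewrite dec-true (b ≟ b) refl = subst (λ a → r ⊖ a ≡ 0F) eq (⊖-self r)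

    next : ∀ c → Any (λ u → proj₁ u ≡ c ⊖ t) (relabel t s x ∷ us) ⊎ leader xs c ≡ s c
    next c with b ≟ c | known c
    -- The block of `x` is entered now; for any other block the leader of the tail is that of the
    -- whole word.
    ... | yes refl | _       = inj₁ (here refl)
    ... | no  _    | inj₁ a  = inj₁ (there a)
    ... | no  _    | inj₂ eq = inj₂ eq

-- Rotating the blocks by that of the first letter, and each block by its leader, moves the word to
-- the checked representative of its orbit.
proper-word : ∀ xs → Unique xs → length xs ≡ 9 → Proper xs
proper-word xs@(x@(b , r) ∷ ys) uniq len =
  Proper-relabel b s (normalised head≡0 (trans (length-map _ ys) (suc-injective len)) walk)
  where
  s : Fin 3 → Fin 3
  s = leader xs

  walk : Walk [] (map (relabel b s) xs)
  walk = relabel-walk b s [] xs uniq (All.universal (λ _ ()) xs) (λ _ → inj₂ refl)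

  head≡0 : relabel b s x ≡ (0F , 0F)
  head≡0 rewrite dec-true (b ≟ b) refl = cong₂ _,_ (⊖-self b) (⊖-self r)

  -- The head is generalised to a variable so that its equation can be matched by `refl`.
  normalised : ∀ {z zs} → z ≡ (0F , 0F) → length zs ≡ 8 → Walk [] (z ∷ zs) → Proper (z ∷ zs)
  normalised refl len (_ ∷ w) = allProper _ len w

nine : WordColouring 9 4
nine = colour ∘ map letter , λ {xs} (uniq , len) _ f →
  proper-word (map letter xs) (map⁺ letter-injective uniq) (trans (length-map letter xs) len) _ (Flip-map letter f)
  where
  letter : Fin 9 → Letter
  letter = remQuot 3

  letter-injective : ∀ {x y} → letter x ≡ letter y → x ≡ y
  letter-injective {x} {y} eq =
    trans (sym (combine-remQuot {3} 3 x)) (trans (cong (uncurry Fin.combine) eq) (combine-remQuot {3} 3 y))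

-- Assembling the bound

-- The induction starts at one copy of `nine` and treats `r = 0` apart: the empty word admits no
-- colouring with `χP 0 = 0` colours.
ninefold : ∀ q r → WordColouring (suc q * 9 + r) (suc q * 4 + χP r)
ninefold zero    zero    = nine
ninefold zero    (suc r) =
  WordColouring-+ nine (Colourable⇒WordColouring (proj₁ (χ-isChromaticNumber (Pancake (suc r)))))
ninefold (suc q) r       = WordColouring-+ nine (ninefold q r)

χP-least : ∀ {n k} → WordColouring n k → χP n ≤ k
χP-least {zero}  _ = z≤n
χP-least {suc n} c = proj₂ (χ-isChromaticNumber (Pancake (suc n))) (WordColouring⇒Colourable c)

theorem1 : ∀ (n : ℕ) → 9 ≤ n → χP n ≤ 4 * (n / 9) + χP (n % 9)
theorem1 n 9≤n with n / 9 in eq | m≥n⇒m/n>0 9≤n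
-- Since `9 ≤ n`, the quotient is positive, which rules out the case `zero`.
... | suc q | _ =
  subst₂ (λ a b → χP a ≤ b + χP (n % 9)) (sym n≡) (*-comm (suc q) 4) (χP-least (ninefold q (n % 9)))
  where
  n≡ : n ≡ suc q * 9 + n % 9
  n≡ = trans (m≡m%n+[m/n]*n n 9) (trans (cong (λ a → n % 9 + a * 9) eq) (+-comm (n % 9) _))
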